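{- Let $r\ge 2$ be an integer. The following four assertions are equivalent. (1) For every finite biclique $G$ and every coloring of $E(G)$ with $r$ colors, $V(G)$ can be covered by the vertex sets of at most $2r-2$ monochromatic components. (2) For every finite biclique $G$ and every partition of $G$ into $r$ bi-equivalence graphs $G_1,\dots,G_r$, $V(G)$ can be covered by the vertex sets of at most $2r-2$ connected components of the graphs $G_1,\dots,G_r$. (3) For every finite biclique $G$ and every spanning partition of $G$ into $r$ bi-equivalence graphs $G_1,\dots,G_r$, $V(G)$ can be covered by the vertex sets of at most $2r-2$ connected components of the graphs $G_1,\dots,G_r$. (4) For every finite biclique $G$ and every antichain partition of $G$ into $r$ bi-equivalence graphs $G_1,\dots,G_r$, $V(G)$ can be covered by the vertex sets of at most $2r-2$ connected components of the graphs $G_1,\dots,G_r$.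
   Context: A biclique $[X,Y]$ is a complete bipartite graph with nonempty vertex classes $X$ and $Y$. Given an edge coloring, a monochromatic component is a connected component of the subgraph formed by the edges of any one given color. A bi-equivalence graph is a graph each of whose connected components is a biclique. A partition of a biclique $G=[X,Y]$ into bi-equivalence graphs $G_1,\dots,G_r$ means that every edge of $G$ belongs to exactly one $G_i$, each $G_i$ being a bi-equivalence graph. For a connected component $C$ of some $G_i$, the sets $X\cap V(C)$ and $Y\cap V(C)$ are called an $X$-block and a $Y$-block (in color $i$). The partition is spanning if every vertex of $G$ is incident with at least one edge of each $G_i$. An antichain partition is a spanning partition in which no $X$-block (of any color) is properly contained in another $X$-block (of any color), and no $Y$-block is properly contained in another $Y$-block. -}

module Defs where

open import Data.Empty using (⊥)
open import Data.Fin.Base using (Fin)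
open import Data.List.Base using (List; length)
open import Data.List.Relation.Unary.Any using (Any)
open import Data.Nat.Base using (ℕ; suc; NonZero; _≤_; _*_; _∸_)
open import Data.Product using (Σ; ∃; ∃!; _×_; _,_; proj₁; proj₂)
open import Data.Sum.Base using (_⊎_; inj₁; inj₂)
open import Data.Unit.Base using (⊤; tt)
open import Function.Bundles using (_⇔_; mk⇔)
open import Level using (0ℓ)
open import Relation.Binary.Core using (Rel)
open import Relation.Binary.Construct.Closure.ReflexiveTransitive
  using (Star; ε; _◅_; _◅◅_)
open import Relation.Binary.Definitions using (Symmetric; Irreflexive)
open import Relation.Binary.PropositionalEquality.Core using (_≡_; refl)
open import Relation.Nullary.Negation.Core using (¬_)
open import Relation.Unary
  using (Pred; _∈_; _⊆_; _⊂_; _≐_; _∪_; _∩_; Empty; Satisfiable)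

-- A simple graph whose vertices form a subset of V, so that the subgraphs of
-- a graph can omit some of its vertices.
record Graph (V : Set) : Set₁ where
  field
    vertices : Pred V 0ℓ
    Adj      : Rel V 0ℓ
    sym      : Symmetric Adj
    irrefl   : Irreflexive _≡_ Adj
    endpoint : ∀ {u v} → Adj u v → u ∈ vertices

open Graph public

module _ {V : Set} where

  record IsSubgraph (H G : Graph V) : Set where
    field
      vertices⊆ : vertices H ⊆ vertices G
      edges⊆    : ∀ {u v} → Adj H u v → Adj G u v

  record IsBiclique (H : Graph V) : Set₁ where
    field
      X Y       : Pred V 0ℓ
      X-inhab   : Satisfiable X
      Y-inhab   : Satisfiable Y
      disjoint  : Empty (X ∩ Y)
      union     : vertices H ≐ X ∪ Y
      complete  : ∀ u v → Adj H u v ⇔ ((u ∈ X × v ∈ Y) ⊎ (u ∈ Y × v ∈ X))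

  -- A connected component is given by any one of its vertices; different
  -- representatives may denote the same component.
  Component : Graph V → Set
  Component H = ∃ (vertices H)

  component : (H : Graph V) → Component H → Graph V
  component H (r , r∈H) = record
    { vertices = Star (Adj H) r
    ; Adj      = λ u v → Star (Adj H) r u × Adj H u v
    ; sym      = λ (p , e) → (p ◅◅ (e ◅ ε)) , sym H e
    ; irrefl   = λ eq (_ , e) → irrefl H eq e
    ; endpoint = proj₁
    }

  -- As the classes of a biclique are inhabited, such a graph has no isolated
  -- vertices; the graph with no vertices is a bi-equivalence graph.
  IsBiEquivalence : Graph V → Set₁
  IsBiEquivalence H = ∀ (C : Component H) → IsBiclique (component H C)

  record IsBiEquivalencePartition (G : Graph V) {r : ℕ}
                                  (H : Fin r → Graph V) : Set₁ where
    field
      subgraph      : ∀ i → IsSubgraph (H i) G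
      biEquivalence : ∀ i → IsBiEquivalence (H i)
      exactlyOne    : ∀ {u v} → Adj G u v → ∃! _≡_ (λ i → Adj (H i) u v)

  IsSpanning : Graph V → {r : ℕ} → (Fin r → Graph V) → Set
  IsSpanning G H = ∀ {v} → v ∈ vertices G → ∀ i → ∃ λ u → Adj (H i) v u

  CoverableBy : ℕ → Graph V → {r : ℕ} → (Fin r → Graph V) → Set
  CoverableBy k G {r} H =
    Σ (List (Σ (Fin r) (λ i → Component (H i)))) λ Cs →
      length Cs ≤ k ×
      (∀ {v} → v ∈ vertices G →
        Any (λ (i , C) → v ∈ vertices (component (H i) C)) Cs)

-- The biclique [Fin m , Fin n]; m and n are required to be nonzero where it is
-- used.
K : (m n : ℕ) → Graph (Fin m ⊎ Fin n)
K m n = record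
  { vertices = λ _ → ⊤
  ; Adj      = E
  ; sym      = λ {u} {v} → E-sym u v
  ; irrefl   = λ {u} → E-irrefl u
  ; endpoint = λ _ → tt
  }
  where
  E : Rel (Fin m ⊎ Fin n) 0ℓ
  E (inj₁ x) (inj₂ y) = ⊤
  E (inj₂ y) (inj₁ x) = ⊤
  E (inj₁ _) (inj₁ _) = ⊥
  E (inj₂ _) (inj₂ _) = ⊥

  E-sym : ∀ u v → E u v → E v u
  E-sym (inj₁ x) (inj₂ y) e = e
  E-sym (inj₂ y) (inj₁ x) e = e

  E-irrefl : ∀ u {v} → u ≡ v → ¬ E u v
  E-irrefl (inj₁ x) refl ()
  E-irrefl (inj₂ y) refl ()

K-isBiclique : ∀ m n .{{_ : NonZero m}} .{{_ : NonZero n}} → IsBiclique (K m n)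
K-isBiclique m@(suc _) n@(suc _) = record
  { X        = InX
  ; Y        = InY
  ; X-inhab  = inj₁ Fin.zero , tt
  ; Y-inhab  = inj₂ Fin.zero , tt
  ; disjoint = λ { (inj₁ _) (_ , ()) ; (inj₂ _) (() , _) }
  ; union    = (λ {v} _ → split v) , (λ _ → tt)
  ; complete = λ
      { (inj₁ _) (inj₁ _) → mk⇔ (λ ()) (λ { (inj₁ (_ , ())) ; (inj₂ (() , _)) })
      ; (inj₁ _) (inj₂ _) → mk⇔ (λ _ → inj₁ (tt , tt)) (λ _ → tt)
      ; (inj₂ _) (inj₁ _) → mk⇔ (λ _ → inj₂ (tt , tt)) (λ _ → tt)
      ; (inj₂ _) (inj₂ _) → mk⇔ (λ ()) (λ { (inj₁ (() , _)) ; (inj₂ (_ , ())) })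
      }
  }
  where
  InX InY : Pred (Fin m ⊎ Fin n) 0ℓ
  InX (inj₁ _) = ⊤
  InX (inj₂ _) = ⊥
  InY (inj₁ _) = ⊥
  InY (inj₂ _) = ⊤

  split : ∀ v → v ∈ InX ∪ InY
  split (inj₁ _) = inj₁ tt
  split (inj₂ _) = inj₂ tt

-- E (K m n) is identified with Fin m × Fin n. Not every colour need occur.
Colouring : (m n r : ℕ) → Set
Colouring m n r = Fin m → Fin n → Fin r

module _ {m n : ℕ} where

  -- The subgraph formed by the edges of colour i: its vertices are the
  -- endpoints of these edges.
  colourClass : ∀ {r} → Colouring m n r → Fin r → Graph (Fin m ⊎ Fin n)
  colourClass c i = record
    { vertices = λ u → ∃ λ v → E u v
    ; Adj      = E
    ; sym      = λ {u} {v} → E-sym u v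
    ; irrefl   = λ {u} → E-irrefl u
    ; endpoint = λ {_} {v} e → v , e
    }
    where
    E : Rel (Fin m ⊎ Fin n) 0ℓ
    E (inj₁ x) (inj₂ y) = c x y ≡ i
    E (inj₂ y) (inj₁ x) = c x y ≡ i
    E (inj₁ _) (inj₁ _) = ⊥
    E (inj₂ _) (inj₂ _) = ⊥

    E-sym : ∀ u v → E u v → E v u
    E-sym (inj₁ x) (inj₂ y) e = e
    E-sym (inj₂ y) (inj₁ x) e = e

    E-irrefl : ∀ u {v} → u ≡ v → ¬ E u v
    E-irrefl (inj₁ x) refl ()
    E-irrefl (inj₂ y) refl ()

  XBlock : (H : Graph (Fin m ⊎ Fin n)) → Component H → Pred (Fin m) 0ℓ
  XBlock H C x = inj₁ x ∈ vertices (component H C)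

  YBlock : (H : Graph (Fin m ⊎ Fin n)) → Component H → Pred (Fin n) 0ℓ
  YBlock H C y = inj₂ y ∈ vertices (component H C)

  record IsAntichainPartition {r : ℕ}
           (H : Fin r → Graph (Fin m ⊎ Fin n)) : Set₁ where
    field
      partition   : IsBiEquivalencePartition (K m n) H
      spanning    : IsSpanning (K m n) H
      X-antichain : ∀ i j (C : Component (H i)) (D : Component (H j)) →
                    ¬ (XBlock (H i) C ⊂ XBlock (H j) D)
      Y-antichain : ∀ i j (C : Component (H i)) (D : Component (H j)) →
                    ¬ (YBlock (H i) C ⊂ YBlock (H j) D)

ColouringCover : ℕ → Set
ColouringCover r =
  ∀ m n .{{_ : NonZero m}} .{{_ : NonZero n}} (c : Colouring m n r) →
  CoverableBy (2 * r ∸ 2) (K m n) (colourClass c)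

PartitionCover : ℕ → Set₁
PartitionCover r =
  ∀ m n .{{_ : NonZero m}} .{{_ : NonZero n}} (H : Fin r → Graph (Fin m ⊎ Fin n)) →
  IsBiEquivalencePartition (K m n) H →
  CoverableBy (2 * r ∸ 2) (K m n) H

SpanningPartitionCover : ℕ → Set₁
SpanningPartitionCover r =
  ∀ m n .{{_ : NonZero m}} .{{_ : NonZero n}} (H : Fin r → Graph (Fin m ⊎ Fin n)) →
  IsBiEquivalencePartition (K m n) H → IsSpanning (K m n) H →
  CoverableBy (2 * r ∸ 2) (K m n) H

AntichainPartitionCover : ℕ → Set₁
AntichainPartitionCover r =
  ∀ m n .{{_ : NonZero m}} .{{_ : NonZero n}} (H : Fin r → Graph (Fin m ⊎ Fin n)) →
  IsAntichainPartition H →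
  CoverableBy (2 * r ∸ 2) (K m n) H

{-# OPTIONS --safe #-}
-- Let uw be an edge of the biclique. The components at u cover the side of w,
-- and those at w cover the side of u. If for two colours i ≠ j the vertices
-- joined to w in colour i or j are already covered by components at u, then the
-- components at w of these colours can be left out, and r + (r - 2) components
-- suffice. This applies whenever
--  * u and w lie in the same component of two colours i and j;
--  * w is incident with no edge of colour i, and uw has colour j;
--  * a block of a component P of colour i is properly contained in a block of a
--    component Q, where u lies in the latter block but not in the former, w lies
--    in the other block of P, and uw has colour j.
-- If the first case does not occur in a colouring, then joining any two
-- vertices of opposite sides in the same component gives a partition into
-- bi-equivalence graphs with the same components.
module Submission where

open import Data.Empty using (⊥-elim)
open import Data.Fin.Base using (Fin; zero)
open import Data.Fin.Properties using (any?; all?) renaming (_≟_ to _≟ᶠ_)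
open import Data.List.Base using (List; []; _∷_; _++_; map; length; mapMaybe; filter; allFin)
open import Data.List.Membership.Propositional using (lose) renaming (_∈_ to _∈ˡ_)
open import Data.List.Membership.Propositional.Properties
  using (∈-map⁺; ∈-++⁺ˡ; ∈-++⁺ʳ; ∈-allFin; ∈-filter⁺)
open import Data.List.Properties
  using (length-++; length-map; length-mapMaybe; filter-notAll; length-tabulate)
open import Data.List.Relation.Unary.Any as Any using (Any; here; there)
import Data.List.Relation.Unary.Any.Properties as Anyₚ
open import Data.Maybe.Base as Maybe using (Maybe)
import Data.Maybe.Relation.Unary.Any as MaybeAny
open import Data.Nat.Base using (ℕ; suc; NonZero; _≤_; _+_; _*_; _∸_; s≤s)
open import Data.Nat.Properties
  using (<-≤-trans; ≤-reflexive; +-mono-≤; +-monoʳ-≤; +-suc; +-identityʳ; ∸-monoˡ-≤; module ≤-Reasoning)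
open import Data.Product.Base using (Σ; ∃; _×_; _,_; proj₁; proj₂; map₂)
open import Data.Sum.Base using (_⊎_; inj₁; inj₂; [_,_]′)
open import Data.Sum.Properties using (≡-dec)
open import Data.Unit.Base using (tt)
open import Function.Base using (id; _∘_)
open import Function.Bundles using (_⇔_; mk⇔; Equivalence)
open import Level using (0ℓ)
open import Relation.Binary.Core using (Rel)
open import Relation.Binary.Definitions using (Decidable; DecidableEquality)
open import Relation.Binary.Construct.Closure.ReflexiveTransitive
  using (Star; ε; _◅_; _◅◅_; _⋆; reverse)
open import Relation.Binary.PropositionalEquality
  using (_≡_; _≢_; refl; trans; cong; subst) renaming (sym to ≡-sym)
open import Relation.Nullary using (¬_; Dec; yes; no)
open import Relation.Nullary.Decidable
  using (_×-dec_; _⊎-dec_; _→-dec_; ¬?; map′; dec⇒maybe; decidable-stable)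
open import Relation.Unary using (_∈_; _⊆_; _⊂_) renaming (Decidable to Decidable₁)
open import Defs

-- Floyd–Warshall: the inner vertices of a Path ws lie in ws.

module Reachability {A : Set} {R : Rel A 0ℓ}
  (_≟_ : DecidableEquality A) (R? : Decidable R) where

  Path : List A → Rel A 0ℓ
  Path []       u v = u ≡ v ⊎ R u v
  Path (w ∷ ws) u v = Path ws u v ⊎ (Path ws u w × Path ws w v)

  path? : ∀ ws → Decidable (Path ws)
  path? []       u v = (u ≟ v) ⊎-dec R? u v
  path? (w ∷ ws) u v = path? ws u v ⊎-dec (path? ws u w ×-dec path? ws w v)

  path-base : ∀ ws {u v} → u ≡ v ⊎ R u v → Path ws u v
  path-base []       p = p
  path-base (_ ∷ ws) p = inj₁ (path-base ws p)

  -- Induction on the position of `v` in `ws`. Loops at the head of the list are cut off, including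
  -- a detour from it through `v` and back.
  path-trans : ∀ {ws u v w} → v ∈ˡ ws → Path ws u v → Path ws v w → Path ws u w
  path-trans (here refl) p q = inj₂ ([ id , proj₁ ]′ p , [ id , proj₂ ]′ q)
  path-trans (there v∈)  (inj₁ p)       (inj₁ q)       = inj₁ (path-trans v∈ p q)
  path-trans (there v∈)  (inj₁ p)       (inj₂ (q , s)) = inj₂ (path-trans v∈ p q , s)
  path-trans (there v∈)  (inj₂ (p , s)) (inj₁ q)       = inj₂ (p , path-trans v∈ s q)
  path-trans (there v∈)  (inj₂ (p , _)) (inj₂ (_ , q)) = inj₂ (p , q)

  path⇒star : ∀ ws {u v} → Path ws u v → Star R u v
  path⇒star []       (inj₁ refl)    = ε
  path⇒star []       (inj₂ e)       = e ◅ ε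
  path⇒star (_ ∷ ws) (inj₁ p)       = path⇒star ws p
  path⇒star (_ ∷ ws) (inj₂ (p , q)) = path⇒star ws p ◅◅ path⇒star ws q

  star? : ∀ ws → (∀ v → v ∈ˡ ws) → Decidable (Star R)
  star? ws all u v = map′ (path⇒star ws) star⇒path (path? ws u v)
    where
    star⇒path : ∀ {u v} → Star R u v → Path ws u v
    star⇒path ε       = path-base ws (inj₁ refl)
    star⇒path (e ◅ p) = path-trans (all _) (path-base ws (inj₂ e)) (star⇒path p)

-- Finite search and adjacency in `K m n`.

module _ {m n : ℕ} where

  private V = Fin m ⊎ Fin n

  star-dec : {R : Rel V 0ℓ} → Decidable R → Decidable (Star R)
  star-dec R? = Reachability.star? (≡-dec _≟ᶠ_ _≟ᶠ_) R?
    (map inj₁ (allFin m) ++ map inj₂ (allFin n)) λ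
    { (inj₁ x) → ∈-++⁺ˡ (∈-map⁺ inj₁ (∈-allFin x))
    ; (inj₂ y) → ∈-++⁺ʳ (map inj₁ (allFin m)) (∈-map⁺ inj₂ (∈-allFin y)) }

  any⊎? : {P : V → Set} → Decidable₁ P → Dec (∃ P)
  any⊎? P? = map′ [ (λ (x , p) → inj₁ x , p) , (λ (y , p) → inj₂ y , p) ]′
    (λ { (inj₁ x , p) → inj₁ (x , p) ; (inj₂ y , p) → inj₂ (y , p) })
    (any? (P? ∘ inj₁) ⊎-dec any? (P? ∘ inj₂))

  K-adj? : Decidable (Adj (K m n))
  K-adj? (inj₁ _) (inj₁ _) = no λ ()
  K-adj? (inj₁ _) (inj₂ _) = yes tt
  K-adj? (inj₂ _) (inj₁ _) = yes tt
  K-adj? (inj₂ _) (inj₂ _) = no λ ()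

  K-dominating : ∀ u w → Adj (K m n) u w → ∀ v → Adj (K m n) u v ⊎ Adj (K m n) w v
  K-dominating (inj₁ _) (inj₂ _) _ (inj₁ _) = inj₂ tt
  K-dominating (inj₁ _) (inj₂ _) _ (inj₂ _) = inj₁ tt
  K-dominating (inj₂ _) (inj₁ _) _ (inj₁ _) = inj₁ tt
  K-dominating (inj₂ _) (inj₁ _) _ (inj₂ _) = inj₂ tt

K-neighbour : ∀ {m n} .{{_ : NonZero m}} .{{_ : NonZero n}} →
  ∀ v → ∃ λ u → Adj (K m n) u v
K-neighbour {n = suc _} (inj₁ _) = inj₂ zero , tt
K-neighbour {m = suc _} (inj₂ _) = inj₁ zero , tt

-- Components keep their representatives and can only grow, because each edge of `H i` expands to a
-- walk in `H′ i`.
coverable-map : ∀ {V k r} {G : Graph V} {H H′ : Fin r → Graph V} →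
  (∀ i → vertices (H i) ⊆ vertices (H′ i)) →
  (∀ i {u v} → Adj (H i) u v → Star (Adj (H′ i)) u v) →
  CoverableBy k G H → CoverableBy k G H′
coverable-map {V} {r = r} {H = H} {H′} v⊆ e⊆ (Cs , len , cov) =
  map f Cs , subst (_≤ _) (≡-sym (length-map f Cs)) len ,
  λ v∈ → Anyₚ.map⁺ (Any.map (λ {C} → e⊆ (proj₁ C) ⋆) (cov v∈))
  where
  f : Σ (Fin r) (Component ∘ H) → Σ (Fin r) (Component ∘ H′)
  f (i , u , u∈) = i , u , v⊆ i u∈

-- Covers by the components at the two ends of an edge.

module Covering {m n r : ℕ} (H : Fin r → Graph (Fin m ⊎ Fin n))
  (adj? : ∀ i → Decidable (Adj (H i)))
  (colour : ∀ {u v} → Adj (K m n) u v → ∃ λ i → Adj (H i) u v) where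

  Reach : Fin r → Rel (Fin m ⊎ Fin n) 0ℓ
  Reach i = Star (Adj (H i))

  reach? : ∀ i → Decidable (Reach i)
  reach? i = star-dec (adj? i)

  Incident : Fin r → Fin m ⊎ Fin n → Set
  Incident i v = ∃ λ u → Adj (H i) v u

  incident? : ∀ i v → Dec (Incident i v)
  incident? i v = any⊎? (adj? i v)

  -- Partial, since `u` need not meet colour `i`. Incidence is tested because finite search decides
  -- it, while membership in `vertices (H i)` is an arbitrary predicate.
  componentAt : Fin m ⊎ Fin n → Fin r → Maybe (Σ (Fin r) (Component ∘ H))
  componentAt u i =
    Maybe.map (λ (_ , e) → i , u , endpoint (H i) e) (dec⇒maybe (incident? i u))

  componentsAt : Fin m ⊎ Fin n → List (Fin r) → List (Σ (Fin r) (Component ∘ H))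
  componentsAt u = mapMaybe (componentAt u)

  private
    Covers : Fin m ⊎ Fin n → Σ (Fin r) (Component ∘ H) → Set
    Covers v (i , C) = v ∈ vertices (component (H i) C)

  componentsAt-covers : ∀ {u v i is} → i ∈ˡ is → Incident i u → Reach i u v →
    Any (Covers v) (componentsAt u is)
  componentsAt-covers {u} {v} {i} {is} i∈ inc p =
    Anyₚ.mapMaybe⁺ (componentAt u) is (Anyₚ.map⁺ (lose i∈ at-i))
    where
    at-i : MaybeAny.Any (Covers v) (componentAt u i)
    at-i with incident? i u
    ... | yes _ = MaybeAny.just p
    ... | no ¬i = ⊥-elim (¬i inc)

  coverable-by-edge : ∀ {i j u w} → i ≢ j → Adj (K m n) u w →
    (∀ {v} → Adj (H i) w v → ∃ λ k → Incident k u × Reach k u v) →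
    (∀ {v} → Adj (H j) w v → ∃ λ k → Incident k u × Reach k u v) →
    CoverableBy (2 * r ∸ 2) (K m n) H
  coverable-by-edge {i} {j} {u} {w} i≢j uw cov-i cov-j =
    componentsAt u all-colours ++ componentsAt w others , length≤ , λ {v} _ → covered v
    where
    all-colours others : List (Fin r)
    all-colours = allFin r
    all-but-j = filter (λ k → ¬? (k ≟ᶠ j)) all-colours
    others = filter (λ k → ¬? (k ≟ᶠ i)) all-but-j

    -- As `i ≢ j`, the colour `i` survives the removal of `j`, so each of the two filters shortens
    -- the list.
    length-others : 2 + length others ≤ r
    length-others = <-≤-trans (s≤s (filter-notAll _ all-but-j
        (lose (∈-filter⁺ _ (∈-allFin i) i≢j) λ ¬i≡i → ¬i≡i refl)))
      (<-≤-trans (filter-notAll _ all-colours (lose (∈-allFin j) λ ¬j≡j → ¬j≡j refl))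
        (≤-reflexive (length-tabulate id)))

    length≤ : length (componentsAt u all-colours ++ componentsAt w others) ≤ 2 * r ∸ 2
    length≤ = begin
      length (componentsAt u all-colours ++ componentsAt w others)
        ≡⟨ length-++ (componentsAt u all-colours) ⟩
      length (componentsAt u all-colours) + length (componentsAt w others)
        ≤⟨ +-mono-≤ (length-mapMaybe _ all-colours) (length-mapMaybe _ others) ⟩
      length all-colours + length others
        ≡⟨ cong (_+ length others) (length-tabulate id) ⟩
      r + length others
        -- The 2 is added before it is subtracted, so truncated subtraction loses nothing.
        ≡⟨ cong (_∸ 2) (trans (+-suc r (suc _)) (cong suc (+-suc r _))) ⟨
      r + (2 + length others) ∸ 2
        ≤⟨ ∸-monoˡ-≤ 2 (+-monoʳ-≤ r length-others) ⟩
      r + r ∸ 2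
        ≡⟨ cong (λ s → r + s ∸ 2) (+-identityʳ r) ⟨
      2 * r ∸ 2 ∎
      where open ≤-Reasoning

    by-u : ∀ {v} → (∃ λ k → Incident k u × Reach k u v) →
      Any (Covers v) (componentsAt u all-colours ++ componentsAt w others)
    by-u (k , inc , p) = Anyₚ.++⁺ˡ (componentsAt-covers (∈-allFin k) inc p)

    covered : ∀ v → Any (Covers v) (componentsAt u all-colours ++ componentsAt w others)
    covered v with K-dominating u w uw v
    ... | inj₁ uv = by-u (map₂ (λ e → (_ , e) , e ◅ ε) (colour uv))
    ... | inj₂ wv with colour wv
    ... | k , e with k ≟ᶠ i | k ≟ᶠ j
    ... | yes refl | _        = by-u (cov-i e)
    ... | no _     | yes refl = by-u (cov-j e)
    ... | no k≢i   | no k≢j   = Anyₚ.++⁺ʳ (componentsAt u all-colours)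
      (componentsAt-covers (∈-filter⁺ _ (∈-filter⁺ _ (∈-allFin k) k≢j) k≢i) (_ , e) (e ◅ ε))

-- Colour classes and their saturations.

module _ {m n r : ℕ} (c : Colouring m n r) where

  colourClass-adj? : ∀ i → Decidable (Adj (colourClass c i))
  colourClass-adj? i (inj₁ x) (inj₂ y) = c x y ≟ᶠ i
  colourClass-adj? i (inj₂ y) (inj₁ x) = c x y ≟ᶠ i
  colourClass-adj? i (inj₁ _) (inj₁ _) = no λ ()
  colourClass-adj? i (inj₂ _) (inj₂ _) = no λ ()

  colour-of : ∀ {u v} → Adj (K m n) u v → ∃ λ i → Adj (colourClass c i) u v
  colour-of {inj₁ x} {inj₂ y} _ = c x y , refl
  colour-of {inj₂ y} {inj₁ x} _ = c x y , refl

saturation : ∀ {V} → Graph V → Graph V → Graph V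
saturation G H = record
  { vertices = vertices H
  ; Adj      = λ u v → Adj G u v × Star (Adj H) u v
  ; sym      = λ (a , p) → sym G a , reverse (sym H) p
  ; irrefl   = λ eq (a , _) → irrefl G eq a
  -- An empty walk would make `u` adjacent to itself in `G`.
  ; endpoint = λ { (a , ε) → ⊥-elim (irrefl G refl a) ; (_ , e ◅ _) → endpoint H e }
  }

-- Two vertices of a component on opposite sides are adjacent in `K m n` and joined by a walk in
-- `H`, hence adjacent in the saturation. The representative and a neighbour of it show that both
-- classes are inhabited.
saturation-biEquivalence : ∀ m n .{{_ : NonZero m}} .{{_ : NonZero n}}
  {H : Graph (Fin m ⊎ Fin n)} →
  (∀ {v} → v ∈ vertices H → ∃ λ u → Adj (saturation (K m n) H) v u) →
  IsBiEquivalence (saturation (K m n) H)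
saturation-biEquivalence m n {H} incident C@(r , r∈) = record
  { X        = λ v → v ∈ B.X × R v
  ; Y        = λ v → v ∈ B.Y × R v
  ; X-inhab  = [ (λ (r∈X , _) → r , r∈X , ε) , (λ (_ , s∈X) → s , s∈X , rs ◅ ε) ]′ sides
  ; Y-inhab  = [ (λ (_ , s∈Y) → s , s∈Y , rs ◅ ε) , (λ (r∈Y , _) → r , r∈Y , ε) ]′ sides
  ; disjoint = λ v ((v∈X , _) , (v∈Y , _)) → B.disjoint v (v∈X , v∈Y)
  ; union    = (λ p → [ (λ q → inj₁ (q , p)) , (λ q → inj₂ (q , p)) ]′ (proj₁ B.union tt))
             , [ proj₂ , proj₂ ]′
  ; complete = λ u v → mk⇔
      (λ (p , e) → [ (λ (q , q′) → inj₁ ((q , p) , (q′ , p ◅◅ e ◅ ε)))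
                   , (λ (q , q′) → inj₂ ((q , p) , (q′ , p ◅◅ e ◅ ε))) ]′
                   (Equivalence.to (B.complete u v) (proj₁ e)))
      [ (λ ((q , p) , (q′ , p′)) → p , Equivalence.from (B.complete u v) (inj₁ (q , q′)) , joined p p′)
      , (λ ((q , p) , (q′ , p′)) → p , Equivalence.from (B.complete u v) (inj₂ (q , q′)) , joined p p′) ]′
  }
  where
  module B = IsBiclique (K-isBiclique m n)
  S = saturation (K m n) H
  R = Star (Adj S) r
  s = proj₁ (incident r∈)
  rs = proj₂ (incident r∈)
  sides = Equivalence.to (B.complete r s) (proj₁ rs)

  joined : ∀ {u v} → R u → R v → Star (Adj H) u v
  joined p p′ = (proj₂ ⋆) (reverse (sym S) p ◅◅ p′)

partition⇒colouring : ∀ {r} → PartitionCover r → ColouringCover r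
partition⇒colouring {r} cover m n c
  -- The search is for an edge of the biclique whose ends share a component in two different
  -- colours.
  with (let open Covering (colourClass c) (colourClass-adj? c) (colour-of c) in
    any? λ i → any? λ j → any? λ x → any? λ y →
    ¬? (i ≟ᶠ j) ×-dec reach? i (inj₁ x) (inj₂ y) ×-dec reach? j (inj₁ x) (inj₂ y))
... | yes (i , j , x , y , i≢j , p , q) = coverable-by-edge i≢j tt (via p) (via q)
  where
  open Covering (colourClass c) (colourClass-adj? c) (colour-of c)
  via : ∀ {k v} → Reach k (inj₁ x) (inj₂ y) → Adj (colourClass c k) (inj₂ y) v →
    ∃ λ k → Incident k (inj₁ x) × Reach k (inj₁ x) v
  -- The walk is nonempty, its ends being on opposite sides; its first edge shows that colour `k`
  -- occurs at `x`.
  via {k} p@(e ◅ _) f = k , (_ , e) , p ◅◅ f ◅ ε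
-- The failed search makes the saturations edge-disjoint; their edges expand to walks in the colour
-- classes, so a cover carries back.
... | no ∄ = coverable-map {G = K m n} {H} {colourClass c} (λ i → id) (λ i → proj₂) (cover m n H record
  { subgraph      = λ i → record { vertices⊆ = λ _ → tt ; edges⊆ = proj₁ }
  ; biEquivalence = λ i → saturation-biEquivalence m n {colourClass c i} λ {v} (u , e) →
      u , colourClass⊆K i v u e , e ◅ ε
  ; exactlyOne    = λ {u} {v} a → let (i , e) = colour-of c a in
      i , (a , e ◅ ε) , λ {j} (_ , p) → unique u v a (e ◅ ε) p
  })
  where
  open Covering (colourClass c) (colourClass-adj? c) (colour-of c)
  H : Fin r → Graph (Fin m ⊎ Fin n)
  H i = saturation (K m n) (colourClass c i)

  colourClass⊆K : ∀ i u v → Adj (colourClass c i) u v → Adj (K m n) u v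
  colourClass⊆K i (inj₁ _) (inj₂ _) _ = tt
  colourClass⊆K i (inj₂ _) (inj₁ _) _ = tt

  unique : ∀ {i j} u v → Adj (K m n) u v → Reach i u v → Reach j u v → i ≡ j
  unique {i} {j} (inj₁ x) (inj₂ y) _ p q =
    decidable-stable (i ≟ᶠ j) λ i≢j → ∄ (i , j , x , y , i≢j , p , q)
  unique {i} {j} (inj₂ y) (inj₁ x) _ p q =
    unique (inj₁ x) (inj₂ y) tt (reverse (sym (colourClass c i)) p) (reverse (sym (colourClass c j)) q)

-- Partitions as colourings.

module Partition {m n r : ℕ} {H : Fin r → Graph (Fin m ⊎ Fin n)}
  (P : IsBiEquivalencePartition (K m n) H) where

  open IsBiEquivalencePartition P

  colour : ∀ {u v} → Adj (K m n) u v → ∃ λ i → Adj (H i) u v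
  colour a = let (i , e , _) = exactlyOne a in i , e

  adj⇒≡ : ∀ {i u v} (a : Adj (K m n) u v) → Adj (H i) u v → proj₁ (colour a) ≡ i
  adj⇒≡ a = proj₂ (proj₂ (exactlyOne a))

  -- The graphs `H i` are arbitrary relations, but an edge of the biclique has a unique colour, and
  -- comparing it with `i` decides adjacency.
  adj? : ∀ i → Decidable (Adj (H i))
  adj? i u v with K-adj? u v
  ... | no ¬a = no (¬a ∘ IsSubgraph.edges⊆ (subgraph i))
  ... | yes a = map′ (λ eq → subst (λ k → Adj (H k) u v) eq (proj₂ (colour a)))
                     (adj⇒≡ a) (proj₁ (colour a) ≟ᶠ i)

  open Covering H adj? colour public

-- Each edge is coloured by the index of its graph; every colour class then lies in the
-- corresponding `H i`.
colouring⇒partition : ∀ {r} → ColouringCover r → PartitionCover r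
colouring⇒partition {r} cover m n H P =
  coverable-map {G = K m n} {colourClass c} {H}
    (λ i (v , e) → endpoint (H i) (⊆H i e)) (λ i e → ⊆H i e ◅ ε) (cover m n c)
  where
  open Partition P
  c : Colouring m n r
  c x y = proj₁ (colour {inj₁ x} {inj₂ y} tt)

  ⊆H : ∀ i {u v} → Adj (colourClass c i) u v → Adj (H i) u v
  ⊆H i {inj₁ x} {inj₂ y} refl = proj₂ (colour {inj₁ x} {inj₂ y} tt)
  ⊆H i {inj₂ y} {inj₁ x} refl = sym (H i) (proj₂ (colour {inj₁ x} {inj₂ y} tt))

-- Partitions in which a vertex misses a colour.

spanning⇒partition : ∀ {r} → SpanningPartitionCover r → PartitionCover r
spanning⇒partition {r} cover m n H P
  with (any? λ i → any⊎? λ v → ¬? (Partition.incident? P i v))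
... | no ∄ = cover m n H P λ {v} _ i →
  decidable-stable (Partition.incident? P i v) λ ¬inc → ∄ (i , v , ¬inc)
... | yes (i , w , ¬inc) = coverable-by-edge i≢j uw
    -- Nothing is joined to `w` in colour `i`; in colour `j`, the edge `uw` leads from `u` to every
    -- neighbour of `w`.
    (λ e → ⊥-elim (¬inc (_ , e)))
    (λ f → j , (w , e) , e ◅ f ◅ ε)
  where
  open Partition P
  u = proj₁ (K-neighbour w)
  uw : Adj (K m n) u w
  uw = proj₂ (K-neighbour w)
  j = proj₁ (colour uw)
  e = proj₂ (colour uw)
  i≢j : i ≢ j
  i≢j refl = ¬inc (u , sym (H i) e)

-- Nested blocks in spanning partitions.

module SpanningPartition {m n r : ℕ} {H : Fin r → Graph (Fin m ⊎ Fin n)}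
  (P : IsBiEquivalencePartition (K m n) H) (spanning : IsSpanning (K m n) H) where

  open Partition P

  -- The embedding `σ` selects the side. Any vertices may serve as `p` and `q`, as spanning puts
  -- each vertex in every `H i`. The explicit witness, unlike the negation in `⊂`, yields the vertex
  -- `u` of the covering argument.
  Nested : ∀ {k} → (Fin k → Fin m ⊎ Fin n) → Set
  Nested σ = ∃ λ i → ∃ λ j → ∃ λ p → ∃ λ q →
    (∀ x → Reach i p (σ x) → Reach j q (σ x)) ×
    ∃ λ x → Reach j q (σ x) × ¬ Reach i p (σ x)

  nested? : ∀ {k} (σ : Fin k → Fin m ⊎ Fin n) → Dec (Nested σ)
  nested? σ = any? λ i → any? λ j → any⊎? λ p → any⊎? λ q →
    all? (λ x → reach? i p (σ x) →-dec reach? j q (σ x)) ×-dec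
    any? λ x → reach? j q (σ x) ×-dec ¬? (reach? i p (σ x))

  ¬nested⇒antichain : ∀ {k} {σ : Fin k → Fin m ⊎ Fin n} → ¬ Nested σ →
    ∀ i j p q → ¬ ((Reach i p ∘ σ) ⊂ (Reach j q ∘ σ))
  ¬nested⇒antichain {σ = σ} ∄ i j p q (⊆ , ⊉) = ⊉ λ {x} qx →
    decidable-stable (reach? i p (σ x)) λ ¬px →
    ∄ (i , j , p , q , (λ _ → ⊆) , x , qx , ¬px)

  nested⇒coverable : ∀ {i j p q u w} → Adj (K m n) u w →
    Reach i p w → Reach j q u → ¬ Reach i p u →
    (∀ {v} → Adj (K m n) w v → Reach i p v → Reach j q v) →
    CoverableBy (2 * r ∸ 2) (K m n) H
  nested⇒coverable {i} {j} {p} {q} {u} {w} uw pw qu ¬pu ⊆ =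
    coverable-by-edge i≢k uw
      -- A neighbour of `w` in colour `i` lies in the component of `p`, so by containment in that of
      -- `q`, which is the component of colour `j` at `u`.
      (λ f → j , spanning tt j ,
        reverse (sym (H j)) qu ◅◅ ⊆ (IsSubgraph.edges⊆ (subgraph i) f) (pw ◅◅ f ◅ ε))
      (λ f → k , (w , e) , e ◅ f ◅ ε)
    where
    open IsBiEquivalencePartition P
    k = proj₁ (colour uw)
    e = proj₂ (colour uw)
    i≢k : i ≢ k
    -- If `uw` had colour `i`, it would carry `u` into the component of `p`.
    i≢k refl = ¬pu (pw ◅◅ sym (H i) e ◅ ε)

  -- An edge of colour `i` at `p` has both ends in the component, one on each side.
  opposite : ∀ i p u → ∃ λ w → Adj (K m n) u w × Reach i p w
  opposite i p u with spanning {p} tt i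
  ... | s , ps with K-dominating p s (IsSubgraph.edges⊆ (IsBiEquivalencePartition.subgraph P i) ps) u
  ... | inj₁ pu = p , sym (K m n) {p} {u} pu , ε
  ... | inj₂ su = s , sym (K m n) {s} {u} su , ps ◅ ε

  X-nested⇒coverable : Nested inj₁ → CoverableBy (2 * r ∸ 2) (K m n) H
  X-nested⇒coverable (i , j , p , q , ⊆ , x , qx , ¬px) with opposite i p (inj₁ x)
  ... | inj₂ y , xy , py = nested⇒coverable {w = inj₂ y} xy py qx ¬px λ { {inj₁ x′} _ → ⊆ x′ }

  Y-nested⇒coverable : Nested inj₂ → CoverableBy (2 * r ∸ 2) (K m n) H
  Y-nested⇒coverable (i , j , p , q , ⊆ , y , qy , ¬py) with opposite i p (inj₂ y)
  ... | inj₁ x , yx , px = nested⇒coverable {w = inj₁ x} yx px qy ¬py λ { {inj₂ y′} _ → ⊆ y′ }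

antichain⇒spanning : ∀ {r} → AntichainPartitionCover r → SpanningPartitionCover r
antichain⇒spanning cover m n H P spanning
  with SpanningPartition.nested? P spanning inj₁ | SpanningPartition.nested? P spanning inj₂
... | yes N | _     = SpanningPartition.X-nested⇒coverable P spanning N
... | no _  | yes N = SpanningPartition.Y-nested⇒coverable P spanning N
... | no ∄X | no ∄Y = cover m n H record
  { partition   = P
  ; spanning    = spanning
  ; X-antichain = λ i j C D → ¬nested⇒antichain ∄X i j (proj₁ C) (proj₁ D)
  ; Y-antichain = λ i j C D → ¬nested⇒antichain ∄Y i j (proj₁ C) (proj₁ D)
  }
  where open SpanningPartition P spanning

-- Specialisations and the equivalences.

partition⇒spanning : ∀ {r} → PartitionCover r → SpanningPartitionCover r
partition⇒spanning cover m n H P _ = cover m n H P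

spanning⇒antichain : ∀ {r} → SpanningPartitionCover r → AntichainPartitionCover r
spanning⇒antichain cover m n H A = cover m n H partition spanning
  where open IsAntichainPartition A

mainTheorem5 : (r : ℕ) → 2 ≤ r →
    (ColouringCover r ⇔ PartitionCover r) ×
    (PartitionCover r ⇔ SpanningPartitionCover r) ×
    (SpanningPartitionCover r ⇔ AntichainPartitionCover r)
mainTheorem5 r _ =
  mk⇔ colouring⇒partition partition⇒colouring ,
  mk⇔ partition⇒spanning spanning⇒partition ,
  mk⇔ spanning⇒antichain antichain⇒spanning
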